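{- Let $\pi\in\mathcal{S}_n$ be a Schröder permutation. Then for every $k\ge1$, $\pi$ avoids the pattern $12\cdots k$ if and only if $\phi(\pi)$ avoids $12\cdots k$.
   Context: A permutation avoids $\tau\in\mathcal{S}_k$ if no subsequence of length $k$ is in the same relative order as $\tau$; $12\cdots k$ is the increasing pattern of length $k$. A Schröder permutation is one avoiding both $1243$ and $2143$. Represent $\pi\in\mathcal{S}_n$ by an $n\times n$ array, rows $i$ numbered top to bottom, columns $j$ left to right, with a dot in square $(i,\pi_i)$. The diagram $D(\pi)$ is the set of squares $(i,j)$ with $\pi_i>j$ and $\pi^{ -1}(j)>i$. The essential set $\mathcal{E}(\pi)$ is the set of $(i,j)\in D(\pi)$ with $(i+1,j)\notin D(\pi)$ and $(i,j+1)\notin D(\pi)$ (squares outside the array count as not in $D(\pi)$). The rank of $(i,j)$ with respect to $\pi$ is $\rho_\pi(i,j)=\#\{k<i:\pi_k<j\}$; $\mathcal{E}_r(\pi)$ is the set of elements of $\mathcal{E}(\pi)$ of rank $r$. A permutation is uniquely determined by its essential set together with the ranks of its elements (Fulton). For a Schröder permutation $\pi\in\mathcal{S}_n$, let $\mathcal{E}^*(\pi)$ be obtained from $\mathcal{E}(\pi)$ by replacing each $(i,j)\in\mathcal{E}_1(\pi)$ by $(i-1,j-1)$; there is a unique $\sigma\in\mathcal{S}_n$ with $\mathcal{E}(\sigma)=\mathcal{E}^*(\pi)$ and all elements of $\mathcal{E}(\sigma)$ of rank $0$ (with respect to $\sigma$), and $\phi(\pi):=\sigma$ (a $132$-avoiding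 permutation). -}

module Defs where

open import Data.Nat.Base using (ℕ; suc)
open import Data.Fin.Base using (Fin; toℕ; _<_)
open import Data.Fin.Patterns using (0F; 1F; 2F; 3F)
open import Data.Fin.Permutation using (Permutation′; _⟨$⟩ʳ_; _⟨$⟩ˡ_; transpose; _∘ₚ_)
  renaming (id to idₚ)
open import Data.Fin.Properties using (_<?_)
open import Data.List.Base using (allFin; filter; length)
open import Data.Product.Base using (_×_; _,_; Σ-syntax; ∃-syntax)
open import Data.Sum.Base using (_⊎_)
open import Data.Vec.Base using (_∷_; []; tabulate)
open import Function.Bundles using (_⇔_)
open import Level using (0ℓ)
open import Relation.Binary.PropositionalEquality using (_≡_; refl)
open import Relation.Nullary using (¬_)
open import Relation.Nullary.Decidable using (_×-dec_)
open import Relation.Unary using (Pred; _≐_)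

-- The permutations of {1, …, n} are represented as permutations of Fin n, so
-- that positions and values are shifted down by one: π_i is π ⟨$⟩ʳ i and
-- π⁻¹(j) is π ⟨$⟩ˡ j.

Contains : ∀ {n k} → Permutation′ n → Permutation′ k → Set
Contains {n} {k} π τ =
  Σ[ e ∈ (Fin k → Fin n) ]
    (∀ {a b} → a < b → e a < e b) ×
    (∀ a b → (π ⟨$⟩ʳ e a < π ⟨$⟩ʳ e b) ⇔ (τ ⟨$⟩ʳ a < τ ⟨$⟩ʳ b))

Avoids : ∀ {n k} → Permutation′ n → Permutation′ k → Set
Avoids π τ = ¬ Contains π τ

increasing : ∀ k → Permutation′ k
increasing k = idₚ

p1243 : Permutation′ 4
p1243 = transpose 2F 3F

p2143 : Permutation′ 4
p2143 = transpose 0F 1F ∘ₚ transpose 2F 3F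

p1243-oneLine : tabulate (p1243 ⟨$⟩ʳ_) ≡ 0F ∷ 1F ∷ 3F ∷ 2F ∷ []
p1243-oneLine = refl

p2143-oneLine : tabulate (p2143 ⟨$⟩ʳ_) ≡ 1F ∷ 0F ∷ 3F ∷ 2F ∷ []
p2143-oneLine = refl

Schröder : ∀ {n} → Permutation′ n → Set
Schröder π = Avoids π p1243 × Avoids π p2143

-- (row , column)
Square : ℕ → Set
Square n = Fin n × Fin n

Diagram : ∀ {n} → Permutation′ n → Pred (Square n) 0ℓ
Diagram π (i , j) = (j < π ⟨$⟩ʳ i) × (i < π ⟨$⟩ˡ j)

-- The neighbours (i+1 , j) and (i , j+1) are quantified over as squares of the
-- array, so a neighbour outside the array imposes no condition.
Essential : ∀ {n} → Permutation′ n → Pred (Square n) 0ℓ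
Essential π (i , j) =
  Diagram π (i , j) ×
  (∀ i⁺ → toℕ i⁺ ≡ suc (toℕ i) → ¬ Diagram π (i⁺ , j)) ×
  (∀ j⁺ → toℕ j⁺ ≡ suc (toℕ j) → ¬ Diagram π (i , j⁺))

rank : ∀ {n} → Permutation′ n → Square n → ℕ
rank {n} π (i , j) =
  length (filter (λ k → (k <? i) ×-dec (π ⟨$⟩ʳ k <? j)) (allFin n))

EssentialOfRank : ∀ {n} → ℕ → Permutation′ n → Pred (Square n) 0ℓ
EssentialOfRank r π s = Essential π s × rank π s ≡ r

-- A square of rank 1 has a dot strictly above and to the left of it, hence
-- lies neither in the first row nor in the first column: its replacement
-- (i-1 , j-1) is always a square of the array.
Essential* : ∀ {n} → Permutation′ n → Pred (Square n) 0ℓ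
Essential* π (i , j) =
  (Essential π (i , j) × ¬ (rank π (i , j) ≡ 1)) ⊎
  (∃[ i⁺ ] ∃[ j⁺ ] toℕ i⁺ ≡ suc (toℕ i) × toℕ j⁺ ≡ suc (toℕ j) ×
                   EssentialOfRank 1 π (i⁺ , j⁺))

-- The graph of φ: for Schröder π there is exactly one σ (up to pointwise
-- equality) with φ[ π ]≡ σ.
φ[_]≡_ : ∀ {n} → Permutation′ n → Permutation′ n → Set
φ[ π ]≡ σ =
  (Essential σ ≐ Essential* π) × (∀ s → Essential σ s → rank σ s ≡ 0)

module Submission where

-- Call a cut into the first a rows and b columns admissible if some dot lies
-- northwest of it and the dots southeast of it increase, i.e. no diagram square
-- lies southeast of it.  There are n - a - b + r dots southeast, r ≥ 1 being the
-- number northwest, so adding one northwest dot to them yields an increasing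
-- subsequence of length at least n - a - b + 2.  Conversely, for an increasing
-- subsequence of a Schröder permutation the cut just before its second dot is
-- admissible, since an inversion southeast of its first two dots would complete a
-- 1243; moving this cut up until r = 1 bounds the length by n - a - b + 2 for
-- some admissible cut.  Finally π and σ have the same admissible cuts with
-- a, b ≥ 1: all diagram squares of σ have rank 0, and the squares (a-1 , b-1) of
-- inadmissible cuts are those weakly northwest of a square of Essential* π.

open import Defs
open import Data.Nat.Base using (ℕ; _≥_)
open import Data.Fin.Permutation using (Permutation′)
open import Function.Bundles using (_⇔_)

open import Algebra.Properties.CommutativeMonoid.Sum as Sum using ()
open import Data.Bool.Base using (Bool; true; false; if_then_else_)
open import Data.Empty using (⊥)
open import Data.Fin.Base using (Fin; zero; suc; toℕ; fromℕ<; inject₁; inject≤; _<_; _≤_)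
open import Data.Fin.Induction using (>-wellFounded)
open import Data.Fin.Patterns using (0F; 1F; 2F; 3F)
open import Data.Fin.Permutation using (_⟨$⟩ʳ_; _⟨$⟩ˡ_; inverseˡ; inverseʳ)
open import Data.Fin.Properties as Fin using (_<?_; <-cmp; any?)
open import Data.List.Base using (List; []; _∷_; allFin; filter; length; lookup; tabulate)
open import Data.List.Membership.Propositional.Properties
  using (∈-filter⁺; ∈-filter⁻; ∈-allFin; ∈-lookup)
open import Data.List.Membership.Setoid.Properties using (index-injective)
open import Data.List.Properties using (length-tabulate)
open import Data.List.Relation.Unary.All as All using ()
open import Data.List.Relation.Unary.AllPairs using (AllPairs; []; _∷_)
open import Data.List.Relation.Unary.AllPairs.Properties as AllPairs using ()
open import Data.List.Relation.Unary.Any using (index)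
open import Data.Nat.Base as ℕ using (zero; suc; _+_; z≤n; s≤s)
open import Data.Nat.Properties as ℕ using ()
open import Data.Product.Base using (_×_; _,_; proj₁; proj₂; ∃; ∃-syntax; Σ-syntax)
open import Data.Sum.Base using (inj₁; inj₂)
open import Data.Vec.Base as Vec using ([]; _∷_)
open import Function.Base using (_∘_; id)
open import Function.Bundles using (Equivalence; mk⇔)
open import Induction.WellFounded using (Acc; acc)
open import Level using (0ℓ)
open import Relation.Binary.Definitions using (tri<; tri≈; tri>)
open import Relation.Binary.PropositionalEquality
  using (_≡_; _≢_; refl; sym; trans; cong; subst; setoid; module ≡-Reasoning)
open import Relation.Nullary using (¬_; yes; no; does; contradiction; ¬?)
open import Relation.Nullary.Decidable using (_×-dec_)
open import Relation.Unary using (Pred; Decidable)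

open Sum ℕ.+-0-commutativeMonoid using (sum; sum-permute)

-- Counting

count : ∀ {n} {P : Pred (Fin n) 0ℓ} → Decidable P → ℕ
count {n} P? = length (filter P? (allFin n))

indicator : Bool → ℕ
indicator b = if b then 1 else 0

length-filter-tabulate : ∀ {n} {A : Set} {P : Pred A 0ℓ} (P? : Decidable P) (f : Fin n → A) →
  length (filter P? (tabulate f)) ≡ sum (λ i → indicator (does (P? (f i))))
length-filter-tabulate {zero}  P? f = refl
length-filter-tabulate {suc n} P? f with does (P? (f zero))
... | true  = cong suc (length-filter-tabulate P? (f ∘ suc))
... | false = length-filter-tabulate P? (f ∘ suc)

sum-indicator-< : ∀ n {a} → a ℕ.≤ n → sum {n} (λ i → indicator (does (toℕ i ℕ.<? a))) ≡ a
sum-indicator-< zero    z≤n       = refl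
sum-indicator-< (suc n) z≤n       = sum-indicator-< n z≤n
sum-indicator-< (suc n) (s≤s a≤n) = cong suc (sum-indicator-< n a≤n)

count-rows : ∀ {n a} → a ℕ.≤ n → count {n} (λ k → toℕ k ℕ.<? a) ≡ a
count-rows {n} {a} a≤n =
  trans (length-filter-tabulate {n} (λ k → toℕ k ℕ.<? a) id) (sum-indicator-< n a≤n)

-- Permuting the summands by `π` turns a count of values into a count of positions.
count-columns : ∀ {n b} (π : Permutation′ n) → b ℕ.≤ n →
  count (λ k → toℕ (π ⟨$⟩ʳ k) ℕ.<? b) ≡ b
count-columns {n} π b≤n = trans
  (length-filter-tabulate (λ k → toℕ (π ⟨$⟩ʳ k) ℕ.<? _) id)
  (trans (sym (sum-permute _ π)) (sum-indicator-< n b≤n))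

inclusion-exclusion : ∀ {A : Set} {P Q : Pred A 0ℓ} (P? : Decidable P) (Q? : Decidable Q) xs →
  length (filter P? xs) + length (filter Q? xs) +
    length (filter (λ x → ¬? (P? x) ×-dec ¬? (Q? x)) xs)
  ≡ length xs + length (filter (λ x → P? x ×-dec Q? x) xs)
inclusion-exclusion P? Q? []       = refl
inclusion-exclusion P? Q? (x ∷ xs)
  with ih ← inclusion-exclusion P? Q? xs
  with does (P? x) | does (Q? x)
... | true  | true
  rewrite ℕ.+-suc (length (filter P? xs)) (length (filter Q? xs))
        | ℕ.+-suc (length xs) (length (filter (λ x → P? x ×-dec Q? x) xs)) = cong (λ m → suc (suc m)) ih
... | true  | false = cong suc ih
... | false | true
  rewrite ℕ.+-suc (length (filter P? xs)) (length (filter Q? xs)) = cong suc ih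
... | false | false = trans (ℕ.+-suc _ _) (cong suc ih)

AllPairs-lookup : ∀ {A : Set} {R : A → A → Set} {xs : List A} → AllPairs R xs →
  ∀ {i j} → i < j → R (lookup xs i) (lookup xs j)
AllPairs-lookup (px ∷ pxs) {zero}  {suc j} _         = All.lookup px (∈-lookup j)
AllPairs-lookup (px ∷ pxs) {suc i} {suc j} (s≤s i<j) = AllPairs-lookup pxs i<j

StrictMono : ∀ {m n} → (Fin m → Fin n) → Set
StrictMono e = ∀ {i j} → i < j → e i < e j

module _ {n} {P : Pred (Fin n) 0ℓ} (P? : Decidable P) where

  -- Filtering keeps the order of `allFin n`, so the first `m` entries of the filtered list already
  -- increase.
  count⇒chain : ∀ {m} → m ℕ.≤ count P? → Σ[ e ∈ (Fin m → Fin n) ] StrictMono e × (∀ i → P (e i))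
  count⇒chain m≤ =
      (λ i → lookup xs (inject≤ i m≤))
    , (λ {i} {j} i<j → AllPairs-lookup sorted
        (subst (ℕ._< _) (sym (Fin.toℕ-inject≤ i m≤))
          (subst (_ ℕ.<_) (sym (Fin.toℕ-inject≤ j m≤)) i<j)))
    , (λ i → proj₂ (∈-filter⁻ P? {xs = allFin n} (∈-lookup (inject≤ i m≤))))
    where
    xs = filter P? (allFin n)
    sorted : AllPairs _<_ xs
    sorted = AllPairs.filter⁺ P? (AllPairs.tabulate⁺-< id)

  -- Distinct elements occupy distinct places in the filtered list, so taking indices embeds the
  -- chain into it.
  chain⇒count : ∀ {m} (e : Fin m → Fin n) → StrictMono e → (∀ i → P (e i)) → m ℕ.≤ count P?
  chain⇒count e mono Pe = Fin.injective⇒≤ {f = λ i → index (e∈ i)} injective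
    where
    e∈ = λ i → ∈-filter⁺ P? (∈-allFin (e i)) (Pe i)
    injective : ∀ {i j} → index (e∈ i) ≡ index (e∈ j) → i ≡ j
    injective {i} {j} eq with <-cmp i j
    ... | tri< i<j _ _ = contradiction (index-injective (setoid _) (e∈ i) (e∈ j) eq) (Fin.<⇒≢ (mono i<j))
    ... | tri≈ _ i≡j _ = i≡j
    ... | tri> _ _ j<i = contradiction (index-injective (setoid _) (e∈ j) (e∈ i) (sym eq)) (Fin.<⇒≢ (mono j<i))

  ∃⇒count : ∃ P → 1 ℕ.≤ count P?
  ∃⇒count (k , Pk) = chain⇒count {1} (λ _ → k) (λ { {zero} {zero} () }) (λ _ → Pk)

  count⇒∃ : 1 ℕ.≤ count P? → ∃ P
  count⇒∃ 1≤ with e , _ , Pe ← count⇒chain 1≤ = e zero , Pe zero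

-- Patterns

permutation-injective : ∀ {n} (π : Permutation′ n) {i j} → π ⟨$⟩ʳ i ≡ π ⟨$⟩ʳ j → i ≡ j
permutation-injective π eq = trans (sym (inverseˡ π)) (trans (cong (π ⟨$⟩ˡ_) eq) (inverseˡ π))

-- Values are linearly ordered and `τ` is injective, so preserving the order of `τ` already forces
-- reflecting it.
contains : ∀ {n k} (π : Permutation′ n) (τ : Permutation′ k) (e : Fin k → Fin n) → StrictMono e →
  (∀ a b → τ ⟨$⟩ʳ a < τ ⟨$⟩ʳ b → π ⟨$⟩ʳ e a < π ⟨$⟩ʳ e b) → Contains π τ
contains π τ e mono order = e , mono , λ a b → mk⇔ (reflects a b) (order a b)
  where
  reflects : ∀ a b → π ⟨$⟩ʳ e a < π ⟨$⟩ʳ e b → τ ⟨$⟩ʳ a < τ ⟨$⟩ʳ b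
  reflects a b lt with <-cmp (τ ⟨$⟩ʳ a) (τ ⟨$⟩ʳ b)
  ... | tri< τa<τb _ _ = τa<τb
  ... | tri≈ _ τa≡τb _ = contradiction lt
    (Fin.<-irrefl (cong (λ c → π ⟨$⟩ʳ e c) (permutation-injective τ τa≡τb)))
  ... | tri> _ _ τb<τa = contradiction (order b a τb<τa) (Fin.<-asym lt)

strictMono₄ : ∀ {n} {f : Fin 4 → Fin n} → f 0F < f 1F → f 1F < f 2F → f 2F < f 3F → StrictMono f
strictMono₄ p q r {0F} {1F} _ = p
strictMono₄ p q r {0F} {2F} _ = Fin.<-trans p q
strictMono₄ p q r {0F} {3F} _ = Fin.<-trans p (Fin.<-trans q r)
strictMono₄ p q r {1F} {2F} _ = q
strictMono₄ p q r {1F} {3F} _ = Fin.<-trans q r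
strictMono₄ p q r {2F} {3F} _ = r
strictMono₄ p q r {1F} {1F} (s≤s ())
strictMono₄ p q r {2F} {1F} (s≤s ())
strictMono₄ p q r {2F} {2F} (s≤s (s≤s ()))
strictMono₄ p q r {3F} {1F} (s≤s ())
strictMono₄ p q r {3F} {2F} (s≤s (s≤s ()))
strictMono₄ p q r {3F} {3F} (s≤s (s≤s (s≤s ())))

-- `v` runs through the chosen values in the order of the pattern, so comparing neighbours, in
-- position and in value, settles all pairs.
contains₄ : ∀ {n} (π : Permutation′ n) (τ : Permutation′ 4) (e : Fin 4 → Fin n) →
  (let v = λ c → π ⟨$⟩ʳ e (τ ⟨$⟩ˡ c)) →
  e 0F < e 1F → e 1F < e 2F → e 2F < e 3F →
  v 0F < v 1F → v 1F < v 2F → v 2F < v 3F → Contains π τ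
contains₄ π τ e p q r p′ q′ r′ = contains π τ e (strictMono₄ p q r) λ a b τa<τb →
  subst (λ c → π ⟨$⟩ʳ e c < π ⟨$⟩ʳ e b) (inverseˡ τ)
    (subst (λ c → _ < π ⟨$⟩ʳ e c) (inverseˡ τ)
      (strictMono₄ {f = λ c → π ⟨$⟩ʳ e (τ ⟨$⟩ˡ c)} p′ q′ r′ τa<τb))

-- A diagram square is the corner of an inversion, which serves as the "43" of
-- a forbidden pattern.
two-dots⇒¬Diagram : ∀ {n} {π : Permutation′ n} → Schröder π → ∀ {k l x y} → k < l → l < x →
  π ⟨$⟩ʳ k < y → π ⟨$⟩ʳ l < y → ¬ Diagram π (x , y)
two-dots⇒¬Diagram {n} {π} (avoids1243 , avoids2143) {k} {l} {x} {y} k<l l<x πk<y πl<y (y<πx , x<π⁻y)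
  with <-cmp (π ⟨$⟩ʳ k) (π ⟨$⟩ʳ l)
... | tri< πk<πl _ _ = avoids1243 (contains₄ π p1243 e k<l l<x x<π⁻y
    πk<πl (subst (_ <_) (sym (inverseʳ π)) πl<y) (subst (_< _) (sym (inverseʳ π)) y<πx))
  where e = Vec.lookup (k ∷ l ∷ x ∷ (π ⟨$⟩ˡ y) ∷ [])
... | tri≈ _ πk≡πl _ = Fin.<⇒≢ k<l (permutation-injective π πk≡πl)
... | tri> _ _ πl<πk = avoids2143 (contains₄ π p2143 e k<l l<x x<π⁻y
    πl<πk (subst (_ <_) (sym (inverseʳ π)) πk<y) (subst (_< _) (sym (inverseʳ π)) y<πx))
  where e = Vec.lookup (k ∷ l ∷ x ∷ (π ⟨$⟩ˡ y) ∷ [])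

-- The diagram

diagram? : ∀ {n} (π : Permutation′ n) → Decidable (Diagram π)
diagram? π (i , j) = (j <? π ⟨$⟩ʳ i) ×-dec (i <? π ⟨$⟩ˡ j)

module _ {n} (π : Permutation′ n) where

  NorthWest SouthEast : ℕ → ℕ → Pred (Fin n) 0ℓ
  NorthWest a b k = toℕ k ℕ.< a × toℕ (π ⟨$⟩ʳ k) ℕ.< b
  SouthEast a b k = ¬ toℕ k ℕ.< a × ¬ toℕ (π ⟨$⟩ʳ k) ℕ.< b

  northWest? : ∀ a b → Decidable (NorthWest a b)
  northWest? a b k = (toℕ k ℕ.<? a) ×-dec (toℕ (π ⟨$⟩ʳ k) ℕ.<? b)

  southEast? : ∀ a b → Decidable (SouthEast a b)
  southEast? a b k = ¬? (toℕ k ℕ.<? a) ×-dec ¬? (toℕ (π ⟨$⟩ʳ k) ℕ.<? b)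

  -- Inclusion-exclusion for the dots above and the dots left of the cut, with one dot in each row
  -- and column.
  count-southEast : ∀ {a b} → a ℕ.≤ n → b ℕ.≤ n →
    a + b + count (southEast? a b) ≡ n + count (northWest? a b)
  count-southEast {a} {b} a≤n b≤n = begin
    a + b + se                          ≡⟨ cong (λ c → c + b + se) (count-rows a≤n) ⟨
    count above? + b + se               ≡⟨ cong (λ c → count above? + c + se) (count-columns π b≤n) ⟨
    count above? + count left? + se     ≡⟨ inclusion-exclusion above? left? (allFin n) ⟩
    length (allFin n) + nw              ≡⟨ cong (_+ nw) (length-tabulate {n = n} id) ⟩
    n + nw                              ∎
    where
    open ≡-Reasoning
    above? : Decidable (λ k → toℕ k ℕ.< a)
    above? k = toℕ k ℕ.<? a
    left? : Decidable (λ k → toℕ (π ⟨$⟩ʳ k) ℕ.< b)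
    left? k = toℕ (π ⟨$⟩ʳ k) ℕ.<? b
    se = count (southEast? a b)
    nw = count (northWest? a b)

  -- Rank 0, phrased without counting.
  Undotted : Pred (Square n) 0ℓ
  Undotted (i , j) = ∀ k → ¬ NorthWest (toℕ i) (toℕ j) k

  -- The dot of row `x` lies right of column `y` and the dot of column `y` lies below row `x`, so a
  -- dot weakly northwest shares neither.
  Diagram⇒NorthWest : ∀ {x y k} → Diagram π (x , y) → k ≤ x → π ⟨$⟩ʳ k ≤ y →
    NorthWest (toℕ x) (toℕ y) k
  Diagram⇒NorthWest {x} {y} {k} (y<πx , x<π⁻y) k≤x πk≤y =
      Fin.≤∧≢⇒< k≤x (λ { refl → ℕ.<⇒≱ y<πx πk≤y })
    , Fin.≤∧≢⇒< πk≤y (λ { refl → ℕ.<⇒≱ x<π⁻y (subst (_≤ x) (sym (inverseˡ π)) k≤x) })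

  undotted-corner : ∀ {i j} → (∀ k → k ≤ i → ¬ π ⟨$⟩ʳ k ≤ j) → Diagram π (i , j)
  undotted-corner {i} {j} none =
      ℕ.≰⇒> (none i ℕ.≤-refl)
    , ℕ.≰⇒> (λ π⁻j≤i → none (π ⟨$⟩ˡ j) π⁻j≤i (Fin.≤-reflexive (inverseʳ π)))

  -- Step down inside the diagram when possible, otherwise right, until both neighbours fail. No
  -- step brings in a new northwest dot, because the row or column just crossed has its dot
  -- elsewhere; the last component records this.
  essential-southeast : ∀ {i j} → Diagram π (i , j) →
    ∃[ x ] ∃[ y ] Essential π (x , y) × i ≤ x × j ≤ y × (Undotted (i , j) → Undotted (x , y))
  essential-southeast = walk (>-wellFounded _) (>-wellFounded _)
    where
    walk : ∀ {i j} → Acc (λ x y → y < x) i → Acc (λ x y → y < x) j → Diagram π (i , j) →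
      ∃[ x ] ∃[ y ] Essential π (x , y) × i ≤ x × j ≤ y × (Undotted (i , j) → Undotted (x , y))
    walk {i} {j} (acc accᵢ) (acc accⱼ) d@(j<πi , i<π⁻j)
      with any? (λ i⁺ → (toℕ i⁺ ℕ.≟ suc (toℕ i)) ×-dec diagram? π (i⁺ , j))
    ... | yes (i⁺ , i⁺≡1+i , d⁺)
      with x , y , ess , i⁺≤x , j≤y , keep ← walk (accᵢ (ℕ.≤-reflexive (sym i⁺≡1+i))) (acc accⱼ) d⁺
      = x , y , ess
      , ℕ.≤-trans (ℕ.n≤1+n _) (subst (ℕ._≤ toℕ x) i⁺≡1+i i⁺≤x)
      , j≤y
      , λ none → keep λ k (k<i⁺ , πk<j) →
          none k (proj₁ (Diagram⇒NorthWest d (ℕ.s≤s⁻¹ (subst (toℕ k ℕ.<_) i⁺≡1+i k<i⁺)) (ℕ.<⇒≤ πk<j)) , πk<j)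
    ... | no ¬down
      with any? (λ j⁺ → (toℕ j⁺ ℕ.≟ suc (toℕ j)) ×-dec diagram? π (i , j⁺))
    ... | yes (j⁺ , j⁺≡1+j , d⁺)
      with x , y , ess , i≤x , j⁺≤y , keep ← walk (acc accᵢ) (accⱼ (ℕ.≤-reflexive (sym j⁺≡1+j))) d⁺
      = x , y , ess
      , i≤x
      , ℕ.≤-trans (ℕ.n≤1+n _) (subst (ℕ._≤ toℕ y) j⁺≡1+j j⁺≤y)
      , λ none → keep λ k (k<i , πk<j⁺) →
          none k (k<i , proj₂ (Diagram⇒NorthWest d (ℕ.<⇒≤ k<i) (ℕ.s≤s⁻¹ (subst (toℕ (π ⟨$⟩ʳ k) ℕ.<_) j⁺≡1+j πk<j⁺))))
    ... | no ¬right = i , j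
      , (d , (λ i⁺ eq d⁺ → ¬down (i⁺ , eq , d⁺)) , (λ j⁺ eq d⁺ → ¬right (j⁺ , eq , d⁺)))
      , ℕ.≤-refl , ℕ.≤-refl , (λ none → none)

  rank≡0⇒undotted : ∀ s → rank π s ≡ 0 → Undotted s
  rank≡0⇒undotted (i , j) r≡0 k nw
    with () ← subst (1 ℕ.≤_) r≡0 (∃⇒count (northWest? (toℕ i) (toℕ j)) (k , nw))

  undotted⇒rank≢1 : ∀ s → Undotted s → rank π s ≢ 1
  undotted⇒rank≢1 (i , j) none r≡1
    with k , nw ← count⇒∃ (northWest? (toℕ i) (toℕ j)) (ℕ.≤-reflexive (sym r≡1)) = none k nw

  -- Two dots northwest of a diagram square would complete a forbidden pattern, so its rank is 0 or
  -- 1.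
  schröder⇒undotted : Schröder π → ∀ {s} → Diagram π s → rank π s ≢ 1 → Undotted s
  schröder⇒undotted sch {i , j} d r≢1 k nw
    with e , mono , e-nw ← count⇒chain (northWest? (toℕ i) (toℕ j))
           (ℕ.≤∧≢⇒< (∃⇒count (northWest? (toℕ i) (toℕ j)) (k , nw)) (r≢1 ∘ sym))
    = two-dots⇒¬Diagram {π = π} sch (mono {0F} {1F} (s≤s z≤n))
        (proj₁ (e-nw 1F)) (proj₂ (e-nw 0F)) (proj₂ (e-nw 1F)) d

-- Admissible cuts

module _ {n} (π : Permutation′ n) where

  Admissible : ℕ → ℕ → Set
  Admissible a b =
    ∃ (NorthWest π a b) × (∀ x y → a ℕ.≤ toℕ x → b ℕ.≤ toℕ y → ¬ Diagram π (x , y))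

  -- A descent from `k` to `l` would put a diagram square in the row of `k` and the column of `l`;
  -- hence the mixed bounds.
  increasing-southEast : ∀ {a b k l} → Admissible a b → a ℕ.≤ toℕ k → b ℕ.≤ toℕ (π ⟨$⟩ʳ l) →
    k < l → π ⟨$⟩ʳ k < π ⟨$⟩ʳ l
  increasing-southEast {k = k} {l} (_ , empty) a≤k b≤πl k<l with <-cmp (π ⟨$⟩ʳ k) (π ⟨$⟩ʳ l)
  ... | tri< πk<πl _ _ = πk<πl
  ... | tri≈ _ πk≡πl _ = contradiction (permutation-injective π πk≡πl) (Fin.<⇒≢ k<l)
  ... | tri> _ _ πl<πk = contradiction (πl<πk , subst (k <_) (sym (inverseˡ π)) k<l) (empty _ _ a≤k b≤πl)

  private
    shift-corner : ∀ i j m → suc i + suc j + m ≡ 2 + (m + (i + j))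
    shift-corner i j m = trans (cong (λ c → suc c + m) (ℕ.+-suc i j)) (cong (2 +_) (ℕ.+-comm (i + j) m))

  -- With `a = i + 1` and `b = j + 1` the bound says `m + 1 ≤ n - a - b + 2`, written without
  -- subtraction.
  admissible⇒contains : ∀ {m} {i j : Fin n} → Admissible (suc (toℕ i)) (suc (toℕ j)) →
    m + (toℕ i + toℕ j) ℕ.< n → Contains π (increasing (suc m))
  admissible⇒contains {m} {i} {j} adm@((k , k<a , πk<b) , _) bound
    = contains π (increasing (suc m)) e e-mono (λ _ _ → πe-mono)
    where
    a = suc (toℕ i)
    b = suc (toℕ j)

    m≤count : m ℕ.≤ count (southEast? π a b)
    m≤count = ℕ.+-cancelˡ-≤ (a + b) m _ (begin
      a + b + m                          ≡⟨ shift-corner (toℕ i) (toℕ j) m ⟩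
      2 + (m + (toℕ i + toℕ j))          ≤⟨ s≤s bound ⟩
      suc n                              ≡⟨ ℕ.+-comm 1 n ⟩
      n + 1                              ≤⟨ ℕ.+-monoʳ-≤ n (∃⇒count (northWest? π a b) (k , k<a , πk<b)) ⟩
      n + count (northWest? π a b)       ≡⟨ count-southEast π (Fin.toℕ<n i) (Fin.toℕ<n j) ⟨
      a + b + count (southEast? π a b)   ∎)
      where open ℕ.≤-Reasoning

    chain = count⇒chain (southEast? π a b) m≤count

    e : Fin (suc m) → Fin n
    e zero    = k
    e (suc c) = proj₁ chain c

    se : ∀ c → a ℕ.≤ toℕ (e (suc c)) × b ℕ.≤ toℕ (π ⟨$⟩ʳ e (suc c))
    se c with ¬above , ¬left ← proj₂ (proj₂ chain) c = ℕ.≮⇒≥ ¬above , ℕ.≮⇒≥ ¬left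

    e-mono : StrictMono e
    e-mono {zero}  {suc d} _         = ℕ.<-≤-trans k<a (proj₁ (se d))
    e-mono {suc c} {suc d} (s≤s c<d) = proj₁ (proj₂ chain) c<d

    πe-mono : ∀ {c d} → c < d → π ⟨$⟩ʳ e c < π ⟨$⟩ʳ e d
    πe-mono {zero}  {suc d} _   = ℕ.<-≤-trans πk<b (proj₂ (se d))
    πe-mono {suc c} {suc d} c<d =
      increasing-southEast adm (proj₁ (se c)) (proj₂ (se d)) (e-mono {suc c} {suc d} c<d)

  -- While two dots lie above and to the left of an admissible cut, the cut can
  -- be moved up by one row.
  admissible-corner : Schröder π → ∀ {a b m} → Admissible a b → a ℕ.≤ n → b ℕ.≤ n →
    (e : Fin m → Fin n) → StrictMono e → (∀ c → SouthEast π a b (e c)) →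
    Σ[ (i , j) ∈ Square n ] Admissible (suc (toℕ i)) (suc (toℕ j)) × m + (toℕ i + toℕ j) ℕ.< n
  admissible-corner sch {zero}          ((_ , () , _) , _)
  admissible-corner sch {suc _} {zero}  ((_ , _ , ()) , _)
  admissible-corner sch {suc a} {suc b} {m} adm a<n b<n e mono se
    with count (northWest? π (suc a) (suc b)) ℕ.≤? 1
  ... | yes nw≤1 = (fromℕ< a<n , fromℕ< b<n) , corner
    where
    open ℕ.≤-Reasoning
    bound : m + (a + b) ℕ.< n
    bound = ℕ.s≤s⁻¹ (begin
      2 + (m + (a + b))                                   ≡⟨ shift-corner a b m ⟨
      suc a + suc b + m                                   ≤⟨ ℕ.+-monoʳ-≤ (suc a + suc b) (chain⇒count (southEast? π (suc a) (suc b)) e mono se) ⟩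
      suc a + suc b + count (southEast? π (suc a) (suc b))  ≡⟨ count-southEast π a<n b<n ⟩
      n + count (northWest? π (suc a) (suc b))            ≤⟨ ℕ.+-monoʳ-≤ n nw≤1 ⟩
      n + 1                                               ≡⟨ ℕ.+-comm n 1 ⟩
      suc n                                               ∎)
    corner : Admissible (suc (toℕ (fromℕ< a<n))) (suc (toℕ (fromℕ< b<n))) ×
             m + (toℕ (fromℕ< a<n) + toℕ (fromℕ< b<n)) ℕ.< n
    corner rewrite Fin.toℕ-fromℕ< a<n | Fin.toℕ-fromℕ< b<n = adm , bound
  ... | no nw≰1
    with d , d-mono , d-nw ← count⇒chain (northWest? π (suc a) (suc b)) {2} (ℕ.≰⇒> nw≰1)
    -- The upper of the two dots is strictly above the lower one, so it stays northwest after the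
    -- move.
    = admissible-corner sch ((d 0F , ℕ.<-≤-trans d₀<d₁ (ℕ.s≤s⁻¹ (proj₁ (d-nw 1F))) , proj₂ (d-nw 0F)) , empty)
        (ℕ.<⇒≤ a<n) b<n e mono
        (λ c → (λ above → proj₁ (se c) (ℕ.m<n⇒m<1+n above)) , proj₂ (se c))
    where
    d₀<d₁ = d-mono {0F} {1F} (s≤s z≤n)
    empty : ∀ x y → a ℕ.≤ toℕ x → suc b ℕ.≤ toℕ y → ¬ Diagram π (x , y)
    -- The lower dot might seem to share row `x`, but the dot of that row lies right of `y`; so both
    -- dots are northwest of `(x , y)`.
    empty x y a≤x b≤y diag = two-dots⇒¬Diagram {π = π} sch d₀<d₁
      (proj₁ (Diagram⇒NorthWest π diag (ℕ.≤-trans (ℕ.s≤s⁻¹ (proj₁ (d-nw 1F))) a≤x) (ℕ.<⇒≤ πd₁<y)))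
      (ℕ.<-≤-trans (proj₂ (d-nw 0F)) b≤y) πd₁<y diag
      where
      πd₁<y : π ⟨$⟩ʳ d 1F < y
      πd₁<y = ℕ.<-≤-trans (proj₂ (d-nw 1F)) b≤y

  contains⇒admissible : Schröder π → ∀ {m} → Contains π (increasing (suc m)) →
    Σ[ (i , j) ∈ Square n ] Admissible (suc (toℕ i)) (suc (toℕ j)) × m + (toℕ i + toℕ j) ℕ.< n
  contains⇒admissible sch {zero} (e , _) =
    -- A single dot has no successor to cut before; the cut `a = b = n` with an empty chain takes
    -- over.
    admissible-corner sch {m = zero} ((e 0F , Fin.toℕ<n _ , Fin.toℕ<n _) , λ x _ n≤x _ _ → ℕ.<⇒≱ (Fin.toℕ<n x) n≤x)
      ℕ.≤-refl ℕ.≤-refl (λ ()) (λ { {()} }) (λ ())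
  contains⇒admissible sch {suc m} (e , mono , order) =
    -- Counting from 0, the row and column of the second dot are the sizes of the cut just before
    -- it, and the chain starts with that dot.
    admissible-corner sch ((e 0F , e₀<e₁ , πe₀<πe₁) , empty) (Fin.toℕ≤n _) (Fin.toℕ≤n _) (e ∘ suc)
      (λ c<d → mono (s≤s c<d)) southEast
    where
    πe-mono : ∀ {c d} → c < d → π ⟨$⟩ʳ e c < π ⟨$⟩ʳ e d
    πe-mono {c} {d} = Equivalence.from (order c d)
    e₀<e₁   = mono {0F} {1F} (s≤s z≤n)
    πe₀<πe₁ = πe-mono {0F} {1F} (s≤s z≤n)

    southEast : ∀ c → SouthEast π (toℕ (e 1F)) (toℕ (π ⟨$⟩ʳ e 1F)) (e (suc c))
    southEast zero    = ℕ.<-irrefl refl , ℕ.<-irrefl refl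
    southEast (suc c) = ℕ.<-asym (mono {1F} {suc (suc c)} (s≤s (s≤s z≤n)))
                      , ℕ.<-asym (πe-mono {1F} {suc (suc c)} (s≤s (s≤s z≤n)))

    empty : ∀ x y → e 1F ≤ x → π ⟨$⟩ʳ e 1F ≤ y → ¬ Diagram π (x , y)
    empty x y e₁≤x πe₁≤y diag with e₁<x , πe₁<y ← Diagram⇒NorthWest π diag e₁≤x πe₁≤y =
      two-dots⇒¬Diagram {π = π} sch e₀<e₁ e₁<x (Fin.<-trans πe₀<πe₁ πe₁<y) πe₁<y diag

-- Admissible cuts of a permutation and of its image

predecessor : ∀ {n} {i k : Fin n} → k < i → ∃[ i⁻ ] toℕ i ≡ suc (toℕ {n} i⁻)
predecessor {i = suc i} _ = inject₁ i , cong suc (sym (Fin.toℕ-inject₁ i))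

-- Entries 0, 2, 3 of both patterns form a 132, whose first dot lies northwest of the diagram square
-- at the corner of the other two. This makes `contains⇒admissible` available for `σ`.
undotted-diagram⇒schröder : ∀ {n} {π : Permutation′ n} →
  (∀ s → Diagram π s → Undotted π s) → Schröder π
undotted-diagram⇒schröder {π = π} undotted =
    (λ (e , mono , order) → excluded e mono
        (Equivalence.from (order 0F 3F) (s≤s z≤n))
        (Equivalence.from (order 3F 2F) (s≤s (s≤s (s≤s z≤n)))))
  , (λ (e , mono , order) → excluded e mono
        (Equivalence.from (order 0F 3F) (s≤s (s≤s z≤n)))
        (Equivalence.from (order 3F 2F) (s≤s (s≤s (s≤s z≤n)))))
  where
  excluded : (e : Fin 4 → Fin _) → StrictMono e →
    π ⟨$⟩ʳ e 0F < π ⟨$⟩ʳ e 3F → π ⟨$⟩ʳ e 3F < π ⟨$⟩ʳ e 2F → ⊥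
  excluded e mono π0<π3 π3<π2 = undotted (e 2F , π ⟨$⟩ʳ e 3F)
    (π3<π2 , subst (e 2F <_) (sym (inverseˡ π)) (mono {2F} {3F} (s≤s (s≤s (s≤s z≤n)))))
    (e 0F) (mono {0F} {2F} (s≤s z≤n) , π0<π3)

module _ {n} (π σ : Permutation′ n) (sch : Schröder π) (φπ≡σ : φ[ π ]≡ σ) where

  private
    to : ∀ {s} → Essential σ s → Essential* π s
    to = proj₁ (proj₁ φπ≡σ)
    from : ∀ {s} → Essential* π s → Essential σ s
    from = proj₂ (proj₁ φπ≡σ)

  -- A dot northwest of a diagram square is also northwest of the essential square reached from it,
  -- which has rank 0.
  image-undotted : ∀ s → Diagram σ s → Undotted σ s
  image-undotted (i , j) d k (k<i , σk<j)
    with x , y , ess , i≤x , j≤y , _ ← essential-southeast σ d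
    = rank≡0⇒undotted σ (x , y) (proj₂ φπ≡σ (x , y) ess) k
        (ℕ.<-≤-trans k<i i≤x , ℕ.<-≤-trans σk<j j≤y)

  image-schröder : Schröder σ
  image-schröder = undotted-diagram⇒schröder {π = σ} image-undotted

  -- One dot of `σ` northwest of the cut suffices, since diagram squares of `σ` are undotted.
  -- Without it `(i , j)` is in the diagram of `σ`, so a square of `Essential* π` lies weakly
  -- southeast of it.
  admissible⇒image-admissible : ∀ {i j : Fin n} →
    Admissible π (suc (toℕ i)) (suc (toℕ j)) → Admissible σ (suc (toℕ i)) (suc (toℕ j))
  admissible⇒image-admissible {i} {j} ((k , s≤s k≤i , s≤s πk≤j) , empty)
    with any? (northWest? σ (suc (toℕ i)) (suc (toℕ j)))
  ... | yes dot@(l , l<a , σl<b) = dot , λ x y a≤x b≤y d →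
    image-undotted (x , y) d l (ℕ.<-≤-trans l<a a≤x , ℕ.<-≤-trans σl<b b≤y)
  ... | no ¬dot
    with x , y , ess , i≤x , j≤y , _ ← essential-southeast σ
           (undotted-corner σ (λ l l≤i σl≤j → ¬dot (l , s≤s l≤i , s≤s σl≤j)))
    with to ess
  -- An unmoved square is undotted in `π`, yet the dot `k` lies northwest of it.
  ... | inj₁ (essπ , r≢1) = contradiction
    (Diagram⇒NorthWest π (proj₁ essπ) (ℕ.≤-trans k≤i i≤x) (ℕ.≤-trans πk≤j j≤y))
    (schröder⇒undotted π sch (proj₁ essπ) r≢1 k)
  -- A moved square comes from a diagram square one step down and right, thus southeast of the cut.
  ... | inj₂ (x⁺ , y⁺ , x⁺≡1+x , y⁺≡1+y , essπ , _) = contradiction (proj₁ essπ)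
    (empty x⁺ y⁺ (subst (_ ℕ.≤_) (sym x⁺≡1+x) (s≤s i≤x)) (subst (_ ℕ.≤_) (sym y⁺≡1+y) (s≤s j≤y)))

  -- The dot `k` of `σ` rules out essential squares of `σ` weakly southeast of `(i , j)`, and any
  -- failure of admissibility for `π` would produce one.
  image-admissible⇒admissible : ∀ {i j : Fin n} →
    Admissible σ (suc (toℕ i)) (suc (toℕ j)) → Admissible π (suc (toℕ i)) (suc (toℕ j))
  image-admissible⇒admissible {i} {j} ((k , s≤s k≤i , s≤s σk≤j) , _) = dot , empty
    where
    ¬essential : ∀ {x y} → i ≤ x → j ≤ y → ¬ Essential σ (x , y)
    ¬essential i≤x j≤y (d , _) = image-undotted _ d k
      (Diagram⇒NorthWest σ d (ℕ.≤-trans k≤i i≤x) (ℕ.≤-trans σk≤j j≤y))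

    dot : ∃ (NorthWest π (suc (toℕ i)) (suc (toℕ j)))
    dot with any? (northWest? π (suc (toℕ i)) (suc (toℕ j)))
    ... | yes dot = dot
    ... | no ¬dot
      with x , y , ess , i≤x , j≤y , keep ← essential-southeast π
             (undotted-corner π (λ l l≤i πl≤j → ¬dot (l , s≤s l≤i , s≤s πl≤j)))
      -- The essential square inherits undottedness, so its rank is not 1 and it is not moved.
      = contradiction (from (inj₁ (ess , undotted⇒rank≢1 π (x , y) (keep λ l (l<i , πl<j) →
          ¬dot (l , ℕ.m<n⇒m<1+n l<i , ℕ.m<n⇒m<1+n πl<j))))) (¬essential i≤x j≤y)

    empty : ∀ x y → i < x → j < y → ¬ Diagram π (x , y)
    empty x y i<x j<y d
      with u , v , ess , x≤u , y≤v , _ ← essential-southeast π d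
      with i<u ← ℕ.<-≤-trans i<x x≤u | j<v ← ℕ.<-≤-trans j<y y≤v
      with rank π (u , v) ℕ.≟ 1
    ... | no r≢1 = ¬essential (ℕ.<⇒≤ i<u) (ℕ.<⇒≤ j<v) (from (inj₁ (ess , r≢1)))
    ... | yes r≡1
      -- Moving back one row and one column costs only the strictness of `i < u` and `j < v`.
      with u⁻ , u≡1+u⁻ ← predecessor i<u | v⁻ , v≡1+v⁻ ← predecessor j<v
      = ¬essential (ℕ.s≤s⁻¹ (subst (toℕ i ℕ.<_) u≡1+u⁻ i<u)) (ℕ.s≤s⁻¹ (subst (toℕ j ℕ.<_) v≡1+v⁻ j<v))
          (from (inj₂ (u , v , u≡1+u⁻ , v≡1+v⁻ , ess , r≡1)))

theorem3p1 : ∀ (n : ℕ) (π : Permutation′ n) → Schröder π →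
    ∀ (σ : Permutation′ n) → φ[ π ]≡ σ →
    ∀ (k : ℕ) → k ≥ 1 →
    Avoids π (increasing k) ⇔ Avoids σ (increasing k)
theorem3p1 n π sch σ φπ≡σ (suc m) _ = mk⇔
  (λ avoids inσ →
    let _ , adm , bound = contains⇒admissible σ (image-schröder π σ sch φπ≡σ) inσ
    in avoids (admissible⇒contains π (image-admissible⇒admissible π σ sch φπ≡σ adm) bound))
  (λ avoids inπ →
    let _ , adm , bound = contains⇒admissible π sch inπ
    in avoids (admissible⇒contains σ (admissible⇒image-admissible π σ sch φπ≡σ adm) bound))
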